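{- Let $a,b\in\mathbb{N}_0$ with $a+b\neq 0$ and let $\mathbf{c}=(c_1,c_2,\dots)$ be a sequence with $c_j\in\mathbb{N}_0$ for all $j\ge 1$. Let $(y_n)_{n\ge 0}$ be the sequence defined by $y_0=1$ and $y_n=\left|\mathfrak{D}^{\mathbf{c}}_n(a,b)\right|$ for $n\ge 1$, where $\mathfrak{D}^{\mathbf{c}}_n(a,b)$ is the set of colored Dyck words of semilength $(a+b)n$ defined in the context. Then for every $n\ge 1$, $$y_n=\sum_{\ell=1}^n c_\ell \sum_{i_1+\cdots+i_{a\ell+b}=n-\ell} y_{i_1}\cdots y_{i_{a\ell+b}},$$ where the inner sum runs over all $(a\ell+b)$-tuples $(i_1,\dots,i_{a\ell+b})$ of nonnegative integers with sum $n-\ell$.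
   Context: $\mathbb{N}_0=\{0,1,2,\dots\}$. A Dyck word of semilength $m$ is a word in the letters $u$ and $d$ with exactly $m$ letters $u$ and $m$ letters $d$, such that every prefix contains at least as many $u$'s as $d$'s (it encodes a lattice path from $(0,0)$ to $(2m,0)$ staying in the first quadrant, with up-steps $u=(1,1)$ and down-steps $d=(1,-1)$). For $a,b\in\mathbb{N}_0$ with $a+b\ne 0$, $\mathbf{c}=(c_1,c_2,\dots)$ with $c_j\in\mathbb{N}_0$, and $n\ge 1$, the set $\mathfrak{D}^{\mathbf{c}}_n(a,b)$ consists of the Dyck words of semilength $(a+b)n$ that are concatenations of strings of the form $P_0=d$ and $P_j=u^{(a+b)j}d^{\,b(j-1)+1}$ for $j=1,\dots,n$ (each usable any number of times, in any order), such that each maximal $(a+b)j$-ascent substring $u^{(a+b)j}$ (maximal run of consecutive $u$'s, of length $(a+b)j$) is colored in one of $c_j$ different ways; $c_j=0$ means that maximal ascents of length $(a+b)j$ are not allowed. Elements of $\mathfrak{D}^{\mathbf{c}}_n(a,b)$ are words together with a choice of color for each maximal ascent; two elements are equal only if both the words and the colors agree. (Since each $P_j$ with $j\ge1$ ends in at least one $d$, the maximal ascents of such a word are exactly the blocks $u^{(a+b)j}$ of the strings $P_j$, $j\ge 1$, that occur.) -}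

module Defs where

open import Data.Fin.Base using (Fin; zero; suc)
import Data.Fin.Properties as Fin
open import Data.List.Base
  using (List; []; _∷_; _++_; map; concatMap; filter; length; lookup; replicate;
         inits; upTo; allFin; cartesianProductWith; deduplicate)
open import Data.List.Properties using (≡-dec)
open import Data.List.Membership.Propositional using (_∈_)
open import Data.List.Membership.Propositional.Properties
open import Data.List.Relation.Unary.All as All using (All; []; _∷_)
open import Data.List.Relation.Unary.AllPairs using (_∷_)
open import Data.List.Relation.Unary.Any as Any using (here; there)
open import Data.List.Relation.Unary.Any.Properties using (lookup-index)
open import Data.List.Relation.Unary.Unique.Propositional using (Unique)
import Data.List.Membership.DecPropositional as DecMembership
import Data.List.Relation.Unary.Unique.DecPropositional.Properties as DecUnique
open import Data.Nat.Base
open import Data.Nat.DivMod using (_/_)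
open import Data.Nat.ListAction using (sum)
open import Data.Nat.Properties
open import Data.Product.Base using (∃-syntax; _×_; _,_)
open import Data.Vec.Base as Vec using (Vec; []; _∷_)
open import Function.Base using (_∘_)
open import Function.Bundles using (_↔_; mk↔ₛ′)
open import Relation.Binary.Definitions using (DecidableEquality)
open import Relation.Binary.PropositionalEquality
open import Relation.Nullary
open import Relation.Nullary.Decidable using (map′; _×-dec_; recompute)

data Letter : Set where
  u d : Letter

infix 4 _≟ˡ_

_≟ˡ_ : DecidableEquality Letter
u ≟ˡ u = yes refl
u ≟ˡ d = no λ ()
d ≟ˡ u = no λ ()
d ≟ˡ d = yes refl

Word : Set
Word = List Letter

#[_] : Letter → Word → ℕ
#[ x ] w = length (filter (_≟ˡ x) w)

record IsDyck (m : ℕ) (w : Word) : Set where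
  constructor isDyck
  field
    #u≡m     : #[ u ] w ≡ m
    #d≡m     : #[ d ] w ≡ m
    prefixes : All (λ p → #[ d ] p ≤ #[ u ] p) (inits w)

-- The lengths of the maximal runs of u, from left to right.
-- In `ascentsFrom k w`, the word w is preceded by a run of exactly k letters u.
ascentsFrom : ℕ → Word → List ℕ
ascentsFrom zero        []      = []
ascentsFrom ℓ@(suc _)   []      = ℓ ∷ []
ascentsFrom k           (u ∷ w) = ascentsFrom (suc k) w
ascentsFrom zero        (d ∷ w) = ascentsFrom zero w
ascentsFrom ℓ@(suc _)   (d ∷ w) = ℓ ∷ ascentsFrom zero w

ascents : Word → List ℕ
ascents = ascentsFrom zero

P : (a b : ℕ) → ℕ → Word
P a b zero      = d ∷ []
P a b j@(suc i) = replicate ((a + b) * j) u ++ replicate (b * i + 1) d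

IsConcatenation : (a b n : ℕ) → Word → Set
IsConcatenation a b n w = ∃[ js ] All (_≤ n) js × w ≡ concatMap (P a b) js

-- One colour for each maximal ascent. An ascent of length (a + b) * j, that is
-- with j = length / (a + b), has c j possible colours. Maximal ascents are
-- nonempty, so in the words considered below c 0 is never consulted.
Colouring : (a b : ℕ) .{{_ : NonZero (a + b)}} → (ℕ → ℕ) → Word → Set
Colouring a b c w = All (λ len → Fin (c (len / (a + b)))) (ascents w)

-- The proof fields are irrelevant, so that two elements are equal as soon as
-- their words and colours agree.
record 𝔇 (a b : ℕ) .{{_ : NonZero (a + b)}} (c : ℕ → ℕ) (n : ℕ) : Set where
  constructor coloured
  field
    word           : Word
    .dyck          : IsDyck ((a + b) * n) word
    .concatenation : IsConcatenation a b n word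
    colouring      : Colouring a b c word

Finite : Set → Set
Finite A = ∃[ k ] (Fin k ↔ A)

∣_∣ : (A : Set) → {{Finite A}} → ℕ
∣ A ∣ {{k , _}} = k

lookup-injective : {A : Set} {xs : List A} → Unique xs →
                   ∀ i j → lookup xs i ≡ lookup xs j → i ≡ j
lookup-injective (x∉ ∷ !xs) zero    zero    eq = refl
lookup-injective {xs = x ∷ xs} (x∉ ∷ !xs) zero (suc j) eq =
  contradiction eq (All.lookup x∉ (∈-lookup {xs = xs} j))
lookup-injective {xs = x ∷ xs} (x∉ ∷ !xs) (suc i) zero eq =
  contradiction (sym eq) (All.lookup x∉ (∈-lookup {xs = xs} i))
lookup-injective (x∉ ∷ !xs) (suc i) (suc j) eq = cong suc (lookup-injective !xs i j eq)

enumerated⇒finite : {A : Set} → DecidableEquality A →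
                    (xs : List A) → (∀ x → x ∈ xs) → Finite A
enumerated⇒finite _≟_ xs complete = length ys , mk↔ₛ′ (lookup ys) (Any.index ∘ ∈ys)
  (λ x → sym (lookup-index (∈ys x)))
  (λ i → lookup-injective (DecUnique.deduplicate-! _≟_ xs) _ i
           (sym (lookup-index (∈ys (lookup ys i)))))
  where
  ys = deduplicate _≟_ xs
  ∈ys = λ x → ∈-deduplicate⁺ _≟_ (complete x)

isDyck? : ∀ m w → Dec (IsDyck m w)
isDyck? m w =
  map′ (λ (p , q , r) → isDyck p q r) (λ (isDyck p q r) → p , q , r)
    ((#[ u ] w ≟ m) ×-dec (#[ d ] w ≟ m) ×-dec
     All.all? (λ p → #[ d ] p ≤? #[ u ] p) (inits w))

module _ {f : ℕ → ℕ} where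

  All-Fin-≟ : ∀ {ls} → DecidableEquality (All (Fin ∘ f) ls)
  All-Fin-≟ []       []       = yes refl
  All-Fin-≟ (x ∷ xs) (y ∷ ys) =
    map′ (λ { (refl , refl) → refl }) (λ { refl → refl , refl })
      ((x Fin.≟ y) ×-dec All-Fin-≟ xs ys)

  allFins : ∀ ls → List (All (Fin ∘ f) ls)
  allFins []       = [] ∷ []
  allFins (l ∷ ls) = cartesianProductWith _∷_ (allFin (f l)) (allFins ls)

  ∈-allFins : ∀ {ls} (xs : All (Fin ∘ f) ls) → xs ∈ allFins ls
  ∈-allFins []       = here refl
  ∈-allFins (x ∷ xs) = ∈-cartesianProductWith⁺ _∷_ (∈-allFin x) (∈-allFins xs)

lists≤ : {A : Set} → List A → ℕ → List (List A)
lists≤ xs zero    = [] ∷ []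
lists≤ xs (suc k) = [] ∷ cartesianProductWith _∷_ xs (lists≤ xs k)

∈-lists≤ : {A : Set} {xs ys : List A} {k : ℕ} →
           All (_∈ xs) ys → length ys ≤ k → ys ∈ lists≤ xs k
∈-lists≤ {k = zero}  []         _       = here refl
∈-lists≤ {k = suc k} []         _       = here refl
∈-lists≤ {k = suc k} (y∈ ∷ ys∈) (s≤s h) =
  there (∈-cartesianProductWith⁺ _∷_ y∈ (∈-lists≤ ys∈ h))

#d-++ : ∀ v w → #[ d ] (v ++ w) ≡ #[ d ] v + #[ d ] w
#d-++ []      w = refl
#d-++ (u ∷ v) w = #d-++ v w
#d-++ (d ∷ v) w = cong suc (#d-++ v w)

1≤#d-P : ∀ a b j → 1 ≤ #[ d ] (P a b j)
1≤#d-P a b zero    = ≤-refl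
1≤#d-P a b (suc i) = begin
  1                                                   ≤⟨ s≤s z≤n ⟩
  #[ d ] (replicate (1 + b * i) d)                    ≡⟨ cong (λ k → #[ d ] (replicate k d)) (+-comm 1 (b * i)) ⟩
  #[ d ] (replicate (b * i + 1) d)                    ≤⟨ m≤n+m _ _ ⟩
  #[ d ] us + #[ d ] (replicate (b * i + 1) d)        ≡⟨ #d-++ us _ ⟨
  #[ d ] (us ++ replicate (b * i + 1) d)              ∎
  where
  open ≤-Reasoning
  us = replicate ((a + b) * suc i) u

length≤#d : ∀ a b js → length js ≤ #[ d ] (concatMap (P a b) js)
length≤#d a b []       = z≤n
length≤#d a b (j ∷ js) = begin
  1 + length js                                       ≤⟨ +-mono-≤ (1≤#d-P a b j) (length≤#d a b js) ⟩
  #[ d ] (P a b j) + #[ d ] (concatMap (P a b) js)    ≡⟨ #d-++ (P a b j) _ ⟨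
  #[ d ] (P a b j ++ concatMap (P a b) js)            ∎
  where open ≤-Reasoning

module _ (a b : ℕ) .{{_ : NonZero (a + b)}} (c : ℕ → ℕ) (n : ℕ) where

  infix 4 _≟ᴰ_

  _≟ᴰ_ : DecidableEquality (𝔇 a b c n)
  coloured v _ _ xs ≟ᴰ coloured w _ _ ys with ≡-dec _≟ˡ_ v w
  ... | no v≢w   = no λ { refl → v≢w refl }
  ... | yes refl = map′ (λ { refl → refl }) (λ { refl → refl }) (All-Fin-≟ xs ys)

  Valid : List ℕ → Set
  Valid js = All (_≤ n) js × IsDyck ((a + b) * n) (concatMap (P a b) js)

  valid? : ∀ js → Dec (Valid js)
  valid? js = All.all? (_≤? n) js ×-dec isDyck? _ _

  colourings : ∀ js → Dec (Valid js) → List (𝔇 a b c n)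
  colourings js (yes (js≤n , dyck)) =
    map (coloured (concatMap (P a b) js) dyck (js , js≤n , refl)) (allFins _)
  colourings js (no _) = []

  enumeration : List (𝔇 a b c n)
  enumeration =
    concatMap (λ js → colourings js (valid? js)) (lists≤ (upTo (suc n)) ((a + b) * n))

  ∈-colourings : ∀ js (v? : Dec (Valid js)) → Valid js →
                 ∀ .{dyck} .{conc} xs →
                 coloured (concatMap (P a b) js) dyck conc xs ∈ colourings js v?
  ∈-colourings js (yes _) v {dyck} {conc} xs =
    ∈-map⁺ (coloured (concatMap (P a b) js) dyck conc) (∈-allFins xs)
  ∈-colourings js (no ¬v) v xs = contradiction v ¬v

  ∈-enumeration′ : ∀ w → IsDyck ((a + b) * n) w → IsConcatenation a b n w →
                   ∀ .{dyck} .{conc} xs → coloured w dyck conc xs ∈ enumeration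
  ∈-enumeration′ _ dyck (js , js≤n , refl) xs = ∈-concatMap⁺ _
    (Any.map (λ { refl → ∈-colourings js (valid? js) (js≤n , dyck) xs })
      (∈-lists≤ (All.map (∈-upTo⁺ ∘ s≤s) js≤n)
        (≤-trans (length≤#d a b js) (≤-reflexive (IsDyck.#d≡m dyck)))))

  ∈-enumeration : ∀ x → x ∈ enumeration
  ∈-enumeration x@(coloured w dyck conc xs) =
    recompute (x ∈? enumeration) (∈-enumeration′ w dyck conc xs)
    where open DecMembership _≟ᴰ_ using (_∈?_)

instance
  𝔇-finite : ∀ {a b} .{{_ : NonZero (a + b)}} {c n} → Finite (𝔇 a b c n)
  𝔇-finite {a} {b} {c} {n} =
    enumerated⇒finite (_≟ᴰ_ a b c n) (enumeration a b c n) (∈-enumeration a b c n)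

y : (a b : ℕ) .{{_ : NonZero (a + b)}} → (ℕ → ℕ) → ℕ → ℕ
y a b c zero      = 1
y a b c n@(suc _) = ∣ 𝔇 a b c n ∣

infixl 10 ∑
∑ : {A : Set} → List A → (A → ℕ) → ℕ
∑ xs f = sum (map f xs)

syntax ∑ xs (λ x → e) = ∑[ x ∈ xs ] e

∏ : {k : ℕ} → Vec ℕ k → ℕ
∏ = Vec.foldr _ _*_ 1

-- All k-tuples of natural numbers with sum m, each listed once.
tuples : (k m : ℕ) → List (Vec ℕ k)
tuples zero    zero    = [] ∷ []
tuples zero    (suc _) = []
tuples (suc k) m       = concatMap (λ i → map (i ∷_) (tuples k (m ∸ i))) (upTo (suc m))

{-# OPTIONS --safe #-}
-- Read P j as a preorder symbol: P 0 = d is a leaf and P ℓ a node with aℓ + b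
-- children. A concatenation of the P j is a Dyck word exactly when, after one
-- more d is appended, it is the Łukasiewicz word of a plane tree. Removing the
-- root P ℓ leaves the word of a forest of aℓ + b trees, and the word of a forest
-- factors uniquely into words of trees.
module Submission where

open import Data.List.Base using (applyUpTo)
open import Data.Nat.Base using (ℕ; suc; NonZero; _+_; _*_; _∸_; _≥_)
open import Data.Vec.Base using (map)
open import Relation.Binary.PropositionalEquality using (_≡_)
open import Defs

open import Data.Empty using (⊥; ⊥-elim-irr)
open import Data.Fin.Base using (Fin; zero)
open import Data.Fin.Permutation using (↔⇒≡)
open import Data.Fin.Properties using (+↔⊎; *↔×)
open import Data.Irrelevant using ([_])
import Data.List.Base as List
open import Data.List.Base
  using (List; []; _∷_; _++_; _∷ʳ_; concatMap; inits; length; replicate; upTo)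
open import Data.List.Membership.Propositional using (find)
open import Data.List.Membership.Propositional.Properties
  using (∈-concatMap⁻; ∈-map⁻)
open import Data.List.Properties
  using (∷-injective; ∷ʳ-injectiveˡ; ++-assoc; ++-cancelˡ; filter-++; length-++;
         map-++; map-applyUpTo; map-cong; map-∘; map-upTo)
open import Data.List.Relation.Unary.All as All using (All; []; _∷_)
import Data.List.Relation.Unary.All.Properties as All
open import Data.Nat.Base using (zero; pred; _<_; _≤_; s≤s; z≤n; s≤s⁻¹; >-nonZero; >-nonZero⁻¹)
open import Data.Nat.DivMod using (_/_; m*n/n≡m)
open import Data.Nat.ListAction using (sum)
open import Data.Nat.ListAction.Properties using (sum-++)
open import Data.Nat.Properties
open import Data.Nat.Solver using (module +-*-Solver)
open import Data.Product.Base as Product using (Σ; ∃-syntax; _×_; _,_; proj₁; proj₂; uncurry)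
open import Data.Product.Function.NonDependent.Propositional using (_×-↔_)
open import Data.Product.Properties.WithK using (,-injectiveʳ)
open import Data.Refinement.Base using (Refinement; Refinement-syntax; _,_; refine)
open import Data.Sum.Base using (_⊎_; inj₁; inj₂; [_,_]′)
open import Data.Sum.Function.Propositional using (_⊎-↔_)
open import Data.Unit.Base using (⊤; tt)
open import Data.Vec.Base using (Vec; []; _∷_)
open import Function.Base using (_∘_; id)
open import Function.Bundles using (_↔_; mk↔ₛ′; mk⤖; Injection; Inverse)
open import Function.Properties.Bijection using (⤖⇒↔)
open import Function.Properties.Inverse using (↔-sym; ↔-trans; ↔⇒↣)
open import Relation.Binary.PropositionalEquality
  using (refl; sym; trans; cong; cong₂; subst; _≢_; module ≡-Reasoning)
open import Relation.Nullary using (¬_; yes; no; contradiction; _×-dec_)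
open import Relation.Nullary.Decidable using (recompute)
open import Relation.Unary using (Decidable)

-- Counting subsets

-- The membership proof in the refinement is irrelevant, so each `x` counts once, however many
-- proofs `P x` has.
Card : {A : Set} → (A → Set) → ℕ → Set
Card {A} P N = [ x ∈ A ∣ P x ] ↔ Fin N

module _ {A B : Set} {P : A → Set} where

  -- Injectivity is asked only of the underlying elements: their irrelevant proofs then agree
  -- automatically.
  bijection : Decidable P → (g : [ x ∈ A ∣ P x ] → B) →
              (∀ {x x′} .p .p′ → g (x , [ p ]) ≡ g (x′ , [ p′ ]) → x ≡ x′) →
              (∀ y → ∃[ x ] Σ (P x) λ p → y ≡ g (x , [ p ])) →
              [ x ∈ A ∣ P x ] ↔ B
  bijection P? g inj onto = ⤖⇒↔ (mk⤖ {to = g} (injective , surjective))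
    where
    injective : ∀ {x x′} → g x ≡ g x′ → x ≡ x′
    injective {x , [ p ]} {x′ , [ p′ ]} eq with refl ← inj {x} {x′} p p′ eq = refl

    surjective : ∀ y → ∃[ x ] (∀ {z} → z ≡ x → g z ≡ y)
    surjective y with x , p , eq ← onto y = (x , [ p ]) , λ { refl → sym eq }

module _ {A B : Set} {P : A → Set} {Q : B → Set} (P? : Decidable P) (Q? : Decidable Q) where

  -- Decidability recovers usable membership proofs from the irrelevant ones, so `inj` and `onto`
  -- may inspect their arguments.
  card-image : ∀ {N} (g : B → A) → (∀ {y} → Q y → P (g y)) →
               (∀ {y y′} → Q y → Q y′ → g y ≡ g y′ → y ≡ y′) →
               (∀ {x} → P x → ∃[ y ] Q y × x ≡ g y) →
               Card Q N → Card P N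
  card-image g Q⇒P inj onto = ↔-trans (↔-sym (bijection Q? h h-injective h-onto))
    where
    h : [ y ∈ B ∣ Q y ] → [ x ∈ A ∣ P x ]
    h (y , [ q ]) = g y , [ Q⇒P q ]

    h-injective : ∀ {y y′} .q .q′ → h (y , [ q ]) ≡ h (y′ , [ q′ ]) → y ≡ y′
    h-injective {y} {y′} q q′ eq =
      inj (recompute (Q? y) q) (recompute (Q? y′) q′) (cong Refinement.value eq)

    h-onto : ∀ x → ∃[ y ] Σ (Q y) λ q → x ≡ h (y , [ q ])
    h-onto (x , [ p ]) with y , q , refl ← onto (recompute (P? x) p) = y , q , refl

module _ {A : Set} {P : A → Set} where

  card-unique : ∀ {M N} → Card P M → Card P N → M ≡ N
  card-unique ∣P∣≡M ∣P∣≡N = ↔⇒≡ (↔-trans (↔-sym ∣P∣≡M) ∣P∣≡N)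

  card-∅ : (∀ x → ¬ P x) → Card P 0
  card-∅ ¬P = mk↔ₛ′ (λ { (x , [ p ]) → ⊥-elim-irr (¬P x p) }) (λ ())
    (λ ()) (λ { (x , [ p ]) → ⊥-elim-irr (¬P x p) })

  card-⇔ : ∀ {Q : A → Set} {N} → (∀ {x} → Q x → P x) → (∀ {x} → P x → Q x) →
           Card Q N → Card P N
  card-⇔ Q⇒P P⇒Q = ↔-trans (mk↔ₛ′ (refine P⇒Q) (refine Q⇒P) (λ _ → refl) (λ _ → refl))

  card-split : ∀ {R : A → Set} {M N} → Decidable R →
               Card (λ x → P x × R x) M → Card (λ x → P x × ¬ R x) N → Card P (M + N)
  card-split {R} R? ∣R∣≡M ∣¬R∣≡N =
    ↔-trans (↔-trans (mk↔ₛ′ to from to∘from from∘to) (∣R∣≡M ⊎-↔ ∣¬R∣≡N)) (↔-sym +↔⊎)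
    where
    to : [ x ∈ A ∣ P x ] → [ x ∈ A ∣ P x × R x ] ⊎ [ x ∈ A ∣ P x × ¬ R x ]
    to (x , [ p ]) with R? x
    ... | yes r = inj₁ (x , [ p , r ])
    ... | no ¬r = inj₂ (x , [ p , ¬r ])

    from : [ x ∈ A ∣ P x × R x ] ⊎ [ x ∈ A ∣ P x × ¬ R x ] → [ x ∈ A ∣ P x ]
    from = [ refine proj₁ , refine proj₁ ]′

    to∘from : ∀ z → to (from z) ≡ z
    to∘from (inj₁ (x , [ pr ])) with R? x
    ... | yes _ = refl
    ... | no ¬r = ⊥-elim-irr (¬r (proj₂ pr))
    to∘from (inj₂ (x , [ p¬r ])) with R? x
    ... | yes r = ⊥-elim-irr (proj₂ p¬r r)
    ... | no _  = refl

    from∘to : ∀ z → from (to z) ≡ z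
    from∘to (x , [ p ]) with R? x
    ... | yes _ = refl
    ... | no _  = refl

card-⊤ : ∀ N → Card {Fin N} (λ _ → ⊤) N
card-⊤ N = mk↔ₛ′ Refinement.value (_, [ tt ]) (λ _ → refl) (λ _ → refl)

card-× : ∀ {A B : Set} {P : A → Set} {Q : B → Set} {M N} → Card P M → Card Q N →
         Card (λ (x , y) → P x × Q y) (M * N)
card-× {A} {B} {P} {Q} ∣P∣≡M ∣Q∣≡N =
  ↔-trans (↔-trans (mk↔ₛ′ to from (λ _ → refl) (λ _ → refl)) (∣P∣≡M ×-↔ ∣Q∣≡N)) (↔-sym *↔×)
  where
  to : [ z ∈ A × B ∣ (P (proj₁ z) × Q (proj₂ z)) ] → [ x ∈ A ∣ P x ] × [ y ∈ B ∣ Q y ]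
  to ((x , y) , [ pq ]) = (x , [ proj₁ pq ]) , (y , [ proj₂ pq ])

  from : [ x ∈ A ∣ P x ] × [ y ∈ B ∣ Q y ] → [ z ∈ A × B ∣ (P (proj₁ z) × Q (proj₂ z)) ]
  from ((x , [ p ]) , (y , [ q ])) = (x , y) , [ p , q ]

-- Induction on `n`: the fibre over 0 is split off, and on the rest the statistic `r` is lowered by
-- one. Serves twice below, for the size of the first tree of a forest and for the root of a tree.
card-fibres : ∀ {A : Set} {P : A → Set} (r : A → ℕ) (h : ℕ → ℕ) n →
              (∀ {x} → P x → r x < n) →
              (∀ i → i < n → Card (λ x → P x × r x ≡ i) (h i)) →
              Card P (sum (applyUpTo h n))
card-fibres r h zero    r<0 fibre = card-∅ λ x p → n≮0 (r<0 p)
card-fibres {P = P} r h (suc n) r<1+n fibre =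
  card-split (λ x → r x ≟ 0) (fibre 0 (s≤s z≤n))
    (card-fibres (pred ∘ r) (h ∘ suc) n pred-r<n fibre′)
  where
  pred-r<n : ∀ {x} → P x × r x ≢ 0 → pred (r x) < n
  pred-r<n {x} (p , r≢0) with r x | r<1+n p
  ... | zero  | _         = contradiction refl r≢0
  ... | suc _ | s≤s rx<n  = rx<n

  fibre′ : ∀ i → i < n → Card (λ x → (P x × r x ≢ 0) × pred (r x) ≡ i) (h (suc i))
  fibre′ i i<n = card-⇔
    (λ { (p , eq) → (p , λ eq₀ → 1+n≢0 (trans (sym eq) eq₀)) , cong pred eq })
    (λ { ((p , r≢0) , eq) → p , unpred r≢0 eq })
    (fibre (suc i) (s≤s i<n))
    where
    unpred : ∀ {m} → m ≢ 0 → pred m ≡ i → m ≡ suc i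
    unpred {zero}  m≢0 _  = contradiction refl m≢0
    unpred {suc m} _   eq = cong suc eq

-- Sums over tuples

∑-++ : ∀ {A : Set} (xs ys : List A) f → ∑ (xs ++ ys) f ≡ ∑ xs f + ∑ ys f
∑-++ xs ys f = trans (cong sum (map-++ f xs ys)) (sum-++ (List.map f xs) (List.map f ys))

∑-concatMap : ∀ {A B : Set} (g : A → List B) xs f →
              ∑ (concatMap g xs) f ≡ ∑[ x ∈ xs ] ∑ (g x) f
∑-concatMap g []       f = refl
∑-concatMap g (x ∷ xs) f =
  trans (∑-++ (g x) (concatMap g xs) f) (cong (∑ (g x) f +_) (∑-concatMap g xs f))

∑-*ˡ : ∀ {A : Set} m (xs : List A) f → ∑[ x ∈ xs ] (m * f x) ≡ m * ∑ xs f
∑-*ˡ m []       f = sym (*-zeroʳ m)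
∑-*ˡ m (x ∷ xs) f =
  trans (cong (m * f x +_) (∑-*ˡ m xs f)) (sym (*-distribˡ-+ m (f x) (∑ xs f)))

convolution : (ℕ → ℕ) → ℕ → ℕ → ℕ
convolution f k m = ∑[ i ∈ tuples k m ] ∏ (map f i)

-- Groups the tuples by their first entry `i`, which yields the shape of sum that `card-fibres`
-- produces.
convolution-suc : ∀ f k m → convolution f (suc k) m ≡
                  sum (applyUpTo (λ i → f i * convolution f k (m ∸ i)) (suc m))
convolution-suc f k m = begin
  ∑ (tuples (suc k) m) F
    ≡⟨ ∑-concatMap (λ i → List.map (i ∷_) (tuples k (m ∸ i))) (upTo (suc m)) F ⟩
  ∑[ i ∈ upTo (suc m) ] ∑ (List.map (i ∷_) (tuples k (m ∸ i))) F
    ≡⟨ cong sum (map-cong (λ i → trans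
         (cong sum (sym (map-∘ (tuples k (m ∸ i)))))
         (∑-*ˡ (f i) (tuples k (m ∸ i)) (∏ ∘ map f))) (upTo (suc m))) ⟩
  ∑[ i ∈ upTo (suc m) ] (f i * convolution f k (m ∸ i))
    ≡⟨ cong sum (map-upTo (λ i → f i * convolution f k (m ∸ i)) (suc m)) ⟩
  sum (applyUpTo (λ i → f i * convolution f k (m ∸ i)) (suc m))
    ∎
  where
  open ≡-Reasoning
  F : ∀ {k} → Vec ℕ k → ℕ
  F = ∏ ∘ map f

-- Words in u and d

#-++ : ∀ x v w → #[ x ] (v ++ w) ≡ #[ x ] v + #[ x ] w
#-++ x v w = trans (cong length (filter-++ (_≟ˡ x) v w)) (length-++ (List.filter (_≟ˡ x) v))

#u-replicate-u : ∀ n → #[ u ] (replicate n u) ≡ n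
#u-replicate-u zero    = refl
#u-replicate-u (suc n) = cong suc (#u-replicate-u n)

#u-replicate-d : ∀ n → #[ u ] (replicate n d) ≡ 0
#u-replicate-d zero    = refl
#u-replicate-d (suc n) = #u-replicate-d n

-- The path that starts at height `h` ends at height 0 and never goes below it. Recursion on the
-- word lets whole runs of letters be consumed.
Descends : ℕ → Word → Set
Descends h       (u ∷ w) = Descends (suc h) w
Descends zero    []      = ⊤
Descends (suc h) []      = ⊥
Descends zero    (d ∷ w) = ⊥
Descends (suc h) (d ∷ w) = Descends h w

Nonnegative : ℕ → Word → Set
Nonnegative h w = All (λ p → #[ d ] p ≤ h + #[ u ] p) (inits w)

descends⇒balanced : ∀ h w → Descends h w → #[ d ] w ≡ h + #[ u ] w
descends⇒balanced zero    []      _  = refl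
descends⇒balanced h       (u ∷ w) hw =
  trans (descends⇒balanced (suc h) w hw) (sym (+-suc h (#[ u ] w)))
descends⇒balanced (suc h) (d ∷ w) hw = cong suc (descends⇒balanced h w hw)

descends⇒nonnegative : ∀ h w → Descends h w → Nonnegative h w
descends⇒nonnegative h       []      _  = z≤n ∷ []
descends⇒nonnegative h       (u ∷ w) hw = z≤n ∷ All.map⁺
  (All.map (λ {p} → subst (#[ d ] p ≤_) (sym (+-suc h (#[ u ] p))))
    (descends⇒nonnegative (suc h) w hw))
descends⇒nonnegative (suc h) (d ∷ w) hw = z≤n ∷ All.map⁺
  (All.map s≤s (descends⇒nonnegative h w hw))

balanced⇒descends : ∀ h w → #[ d ] w ≡ h + #[ u ] w → Nonnegative h w → Descends h w
balanced⇒descends zero    []      _  _ = tt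
balanced⇒descends h       (u ∷ w) eq (_ ∷ ps) =
  balanced⇒descends (suc h) w (trans eq (+-suc h (#[ u ] w)))
    (All.map (λ {p} → subst (#[ d ] p ≤_) (+-suc h (#[ u ] p))) (All.map⁻ ps))
-- The prefix consisting of this `d` alone would require 1 ≤ 0.
balanced⇒descends zero    (d ∷ w) _  (_ ∷ () ∷ _)
balanced⇒descends (suc h) (d ∷ w) eq (_ ∷ ps) =
  balanced⇒descends h w (suc-injective eq) (All.map s≤s⁻¹ (All.map⁻ ps))

-- An equality of types rather than an implication, so that it can later be transported along in
-- both directions.
descends-us : ∀ h n w → Descends h (replicate n u ++ w) ≡ Descends (n + h) w
descends-us h zero    w = refl
descends-us h (suc n) w =
  trans (descends-us (suc h) n w) (cong (λ k → Descends k w) (+-suc n h))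

descends-ds : ∀ h n w → Descends (n + h) (replicate n d ++ w) ≡ Descends h w
descends-ds h zero    w = refl
descends-ds h (suc n) w = descends-ds h n w

ascentsFrom-us : ∀ k n w → ascentsFrom k (replicate n u ++ w) ≡ ascentsFrom (n + k) w
ascentsFrom-us k zero    w = refl
ascentsFrom-us k (suc n) w =
  trans (ascentsFrom-u k)
    (trans (ascentsFrom-us (suc k) n w) (cong (λ l → ascentsFrom l w) (+-suc n k)))
  where
  -- `ascentsFrom` matches on `k` first, so its clause for `u` computes only after a case split on
  -- `k`.
  ascentsFrom-u : ∀ k {v} → ascentsFrom k (u ∷ v) ≡ ascentsFrom (suc k) v
  ascentsFrom-u zero    = refl
  ascentsFrom-u (suc k) = refl

ascents-ds : ∀ n w → ascents (replicate n d ++ w) ≡ ascents w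
ascents-ds zero    w = refl
ascents-ds (suc n) w = ascents-ds n w

ascentsFrom-ds : ∀ k .{{_ : NonZero k}} n w →
                 ascentsFrom k (replicate (suc n) d ++ w) ≡ k ∷ ascents w
ascentsFrom-ds (suc k) n w = cong (suc k ∷_) (ascents-ds n w)

-- Keeping `ls` and `j` as variables allows both equations to be matched with `refl`, which avoids
-- transporting colours along them.
All-∷-↔ : ∀ {Q : ℕ → Set} {ls m ms j} (h : ℕ → ℕ) → ls ≡ m ∷ ms → h m ≡ j →
          All (Q ∘ h) ls ↔ (Q j × All (Q ∘ h) ms)
All-∷-↔ h refl refl =
  mk↔ₛ′ All.uncons (uncurry _∷_) (λ _ → refl) (λ { (_ ∷ _) → refl })

-- Łukasiewicz words

module _ (a b : ℕ) .{{_ : NonZero (a + b)}} where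

  -- One more than the net rise of `P a b ℓ`: a node closes one pending tree and opens `arity ℓ` new
  -- ones.
  arity : ℕ → ℕ
  arity zero      = 0
  arity ℓ@(suc _) = a * ℓ + b

  -- Only the symbol `P 0` is childless. This forces the last symbol of a forest to be a leaf.
  0<arity : ∀ i → 0 < arity (suc i)
  0<arity i =
    ≤-trans (>-nonZero⁻¹ (a + b)) (+-monoˡ-≤ b (m≤m*n a (suc i)))

  ascents-P : ∀ i w → ascents (P a b (suc i) ++ w) ≡ (a + b) * suc i ∷ ascents w
  ascents-P i w = begin
    ascents ((us ++ replicate (b * i + 1) d) ++ w)
      ≡⟨ cong ascents (++-assoc us (replicate (b * i + 1) d) w) ⟩
    ascents (us ++ replicate (b * i + 1) d ++ w)
      ≡⟨ ascentsFrom-us 0 ((a + b) * suc i) _ ⟩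
    ascentsFrom ((a + b) * suc i + 0) (replicate (b * i + 1) d ++ w)
      ≡⟨ cong₂ (λ k n → ascentsFrom k (replicate n d ++ w))
           (+-identityʳ ((a + b) * suc i)) (+-comm (b * i) 1) ⟩
    ascentsFrom ((a + b) * suc i) (replicate (suc (b * i)) d ++ w)
      ≡⟨ ascentsFrom-ds ((a + b) * suc i) {{m*n≢0 (a + b) (suc i)}} (b * i) w ⟩
    (a + b) * suc i ∷ ascents w
      ∎
    where
    open ≡-Reasoning
    us = replicate ((a + b) * suc i) u

  -- The first maximal run of `u` has length `(a + b) * suc i`, and the nonzero factor `a + b`
  -- cancels.
  P-++-injective : ∀ i i′ w w′ → P a b (suc i) ++ w ≡ P a b (suc i′) ++ w′ → i ≡ i′ × w ≡ w′
  P-++-injective i i′ w w′ eq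
    with runs ← ∷-injective
           (trans (sym (ascents-P i w)) (trans (cong ascents eq) (ascents-P i′ w′)))
    with refl ← suc-injective (*-cancelˡ-≡ (suc i) (suc i′) (a + b) (proj₁ runs))
    = refl , ++-cancelˡ (P a b (suc i)) w w′ eq

  P-starts-with-u : ∀ i w → ∃[ v ] P a b (suc i) ++ w ≡ u ∷ v
  P-starts-with-u i w with (a + b) * suc i | m*n≢0 (a + b) (suc i)
  ... | suc _ | _ = _ , refl

  #u-P : ∀ i → #[ u ] (P a b (suc i)) ≡ (a + b) * suc i
  #u-P i = begin
    #[ u ] (P a b (suc i))  ≡⟨ #-++ u (replicate ((a + b) * suc i) u) _ ⟩
    #[ u ] (replicate ((a + b) * suc i) u) + #[ u ] (replicate (b * i + 1) d)
      ≡⟨ cong₂ _+_ (#u-replicate-u ((a + b) * suc i)) (#u-replicate-d (b * i + 1)) ⟩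
    (a + b) * suc i + 0     ≡⟨ +-identityʳ _ ⟩
    (a + b) * suc i         ∎
    where open ≡-Reasoning

  -- The peak height `(a + b) * suc i + h` equals `(b * i + 1) + h′`, so the run of `d` ends at
  -- `h′`. Writing the hypothesis with `suc h′` avoids truncated subtraction.
  descends-P : ∀ i {h h′} w → arity (suc i) + h ≡ suc h′ →
               Descends h (P a b (suc i) ++ w) ≡ Descends h′ w
  descends-P i {h} {h′} w eq = begin
    Descends h ((us ++ ds) ++ w)              ≡⟨ cong (Descends h) (++-assoc us ds w) ⟩
    Descends h (us ++ ds ++ w)                ≡⟨ descends-us h ((a + b) * suc i) (ds ++ w) ⟩
    Descends ((a + b) * suc i + h) (ds ++ w)  ≡⟨ cong (λ k → Descends k (ds ++ w)) heights ⟩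
    Descends ((b * i + 1) + h′) (ds ++ w)     ≡⟨ descends-ds h′ (b * i + 1) w ⟩
    Descends h′ w                             ∎
    where
    open ≡-Reasoning
    us = replicate ((a + b) * suc i) u
    ds = replicate (b * i + 1) d

    heights : (a + b) * suc i + h ≡ (b * i + 1) + h′
    heights = begin
      (a + b) * suc i + h            ≡⟨ solve 4 (λ a b i h →
                                           (a :+ b) :* (con 1 :+ i) :+ h :=
                                           b :* i :+ ((a :* (con 1 :+ i) :+ b) :+ h)) refl a b i h ⟩
      b * i + (arity (suc i) + h)    ≡⟨ cong (b * i +_) eq ⟩
      b * i + suc h′                 ≡⟨ +-assoc (b * i) 1 h′ ⟨
      (b * i + 1) + h′               ∎
      where open +-*-Solver

  -- Forests as lists of coloured symbols

  module _ (c : ℕ → ℕ) where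

    -- The leaf symbol gets one colour, so that all symbols are treated alike.
    palette : ℕ → ℕ
    palette zero      = 1
    palette ℓ@(suc _) = c ℓ

    Symbol : Set
    Symbol = ∃[ j ] Fin (palette j)

    leaf : Symbol
    leaf = 0 , zero

    indices : List Symbol → List ℕ
    indices = List.map proj₁

    size : List Symbol → ℕ
    size = sum ∘ indices

    size-++ : ∀ s t → size (s ++ t) ≡ size s + size t
    size-++ s t = trans (cong sum (map-++ proj₁ s t)) (sum-++ (indices s) (indices t))

    size-leaf : ∀ s → size (s ∷ʳ leaf) ≡ size s
    size-leaf s = trans (size-++ s (leaf ∷ [])) (+-identityʳ (size s))

    -- Preorder reading: `k` is the number of trees still to be read, and the list must end exactly
    -- when none is left.
    IsForest : ℕ → List Symbol → Set
    IsForest zero    []            = ⊤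
    IsForest zero    (_ ∷ _)       = ⊥
    IsForest (suc k) []            = ⊥
    IsForest (suc k) ((j , _) ∷ s) = IsForest (arity j + k) s

    isForest? : ∀ k → Decidable (IsForest k)
    isForest? zero    []            = yes tt
    isForest? zero    (_ ∷ _)       = no id
    isForest? (suc k) []            = no id
    isForest? (suc k) ((j , _) ∷ s) = isForest? (arity j + k) s

    ++-isForest : ∀ k l s t → IsForest k s → IsForest l t → IsForest (k + l) (s ++ t)
    ++-isForest zero    l []            t _  ft = ft
    ++-isForest (suc k) l ((j , x) ∷ s) t fs ft =
      subst (λ m → IsForest m (s ++ t)) (+-assoc (arity j) k l)
        (++-isForest (arity j + k) l s t fs ft)

    isForest-++⁻ : ∀ k l s → IsForest (k + l) s →
                   ∃[ v ] ∃[ w ] (IsForest k v × IsForest l w × s ≡ v ++ w)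
    isForest-++⁻ zero    l s             fs = [] , s , tt , fs , refl
    isForest-++⁻ (suc k) l ((j , x) ∷ s) fs
      with v , w , fv , fw , refl ← isForest-++⁻ (arity j + k) l s
             (subst (λ m → IsForest m s) (sym (+-assoc (arity j) k l)) fs)
      = (j , x) ∷ v , w , fv , fw , refl

    -- Both readings start with `k` pending trees and see the same symbols, so their counters reach
    -- 0 at the same place.
    isForest-prefixFree : ∀ k v w v′ w′ → IsForest k v → IsForest k v′ →
                          v ++ w ≡ v′ ++ w′ → v ≡ v′ × w ≡ w′
    isForest-prefixFree zero    []            w []             w′ _  _   eq = refl , eq
    isForest-prefixFree (suc k) ((j , x) ∷ v) w ((j′ , x′) ∷ v′) w′ fv fv′ eq
      with refl , eq′ ← ∷-injective eq
      = Product.map₁ (cong ((j , x) ∷_))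
          (isForest-prefixFree (arity j + k) v w v′ w′ fv fv′ eq′)

    -- The last symbol must bring the number of pending trees to 0, which a node of positive arity
    -- cannot do.
    isForest-last : ∀ k z s → IsForest k (z ∷ s) → ∃[ t ] z ∷ s ≡ t ∷ʳ leaf
    isForest-last (suc k) (zero  , zero) []      fs = [] , refl
    isForest-last (suc k) (suc i , x)    []      fs with arity (suc i) | 0<arity i
    isForest-last (suc k) (suc i , x)    []      () | suc _ | _
    isForest-last (suc k) (j     , x)    (z ∷ s) fs =
      Product.map ((j , x) ∷_) (cong ((j , x) ∷_)) (isForest-last (arity j + k) z s fs)

    -- Counting trees and forests by size

    Forest : ℕ → ℕ → List Symbol → Set
    Forest k n s = IsForest k s × size s ≡ n

    forest? : ∀ k n → Decidable (Forest k n)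
    forest? k n s = isForest? k s ×-dec (size s ≟ n)

    -- A tree without its final leaf: the words of these lists are the Dyck words, with no extra `d`
    -- appended.
    OpenTree : ℕ → List Symbol → Set
    OpenTree n s = IsForest 1 (s ∷ʳ leaf) × size s ≡ n

    openTree? : ∀ n → Decidable (OpenTree n)
    openTree? n s = isForest? 1 (s ∷ʳ leaf) ×-dec (size s ≟ n)

    card-tree-0 : Card (Forest 1 0) 1
    card-tree-0 = card-image (forest? 1 0) (λ _ → yes tt) (λ _ → leaf ∷ [])
      (λ _ → tt , refl) (λ { {zero} {zero} _ _ _ → refl }) (λ {s} → onto s) (card-⊤ 1)
      where
      onto : ∀ s → Forest 1 0 s → ∃[ i ] ⊤ × s ≡ leaf ∷ []
      onto ((zero , zero) ∷ []) _ = zero , tt , refl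

    card-tree : ∀ {n N} → Card (OpenTree n) N → Card (Forest 1 n) N
    card-tree {n} = card-image (forest? 1 n) (openTree? n) (_∷ʳ leaf)
      (λ { {s} (fs , eq) → fs , trans (size-leaf s) eq })
      (λ {s} {t} _ _ → ∷ʳ-injectiveˡ s t)
      (λ {s} → onto s)
      where
      onto : ∀ s → Forest 1 n s → ∃[ t ] OpenTree n t × s ≡ t ∷ʳ leaf
      onto (z ∷ s) (fs , total) with t , eq ← isForest-last 1 z s fs =
        t , (subst (IsForest 1) eq fs ,
             trans (sym (trans (cong size eq) (size-leaf t))) total) , eq

    card-forest-0 : ∀ f m → Card (Forest 0 m) (convolution f 0 m)
    card-forest-0 f zero = card-image (forest? 0 0) (λ _ → yes tt) (λ _ → [])
      (λ _ → tt , refl) (λ { {zero} {zero} _ _ _ → refl })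
      (λ { {[]} _ → zero , tt , refl }) (card-⊤ 1)
    card-forest-0 f (suc m) = card-∅ λ { [] (_ , ()) ; (_ ∷ _) (() , _) }

    module _ (k m : ℕ) where

      firstSize : List Symbol → ℕ
      firstSize s with isForest? (1 + k) s
      ... | yes fs = size (proj₁ (isForest-++⁻ 1 k s fs))
      -- A default that makes `firstSize` total; it is never taken on a forest of `1 + k` trees.
      ... | no  _  = 0

      -- By prefix-freeness, the factorisation found by `isForest-++⁻` is the given one.
      firstSize-++ : ∀ v w → IsForest 1 v → IsForest k w → firstSize (v ++ w) ≡ size v
      firstSize-++ v w fv fw with isForest? (1 + k) (v ++ w)
      ... | no ¬fvw = contradiction (++-isForest 1 k v w fv fw) ¬fvw
      ... | yes fvw with v′ , w′ , fv′ , _ , eq ← isForest-++⁻ 1 k (v ++ w) fvw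
                    with refl , _ ← isForest-prefixFree 1 v w v′ w′ fv fv′ eq = refl

      -- Forests are grouped by the size `i` of their first tree; cutting it off leaves `k` trees of
      -- total size `m ∸ i`.
      card-forest-suc : ∀ {f g : ℕ → ℕ} → (∀ i → Card (Forest 1 i) (f i)) →
                        (∀ i → Card (Forest k i) (g i)) →
                        Card (Forest (suc k) m) (sum (applyUpTo (λ i → f i * g (m ∸ i)) (suc m)))
      card-forest-suc {f} {g} ∣tree∣ ∣forest∣ =
        card-fibres firstSize _ (suc m) (λ {s} → bounded s) fibre
        where
        bounded : ∀ s → Forest (suc k) m s → firstSize s < suc m
        bounded s (fs , refl) with v , w , fv , fw , refl ← isForest-++⁻ 1 k s fs = s≤s (begin
          firstSize (v ++ w)  ≡⟨ firstSize-++ v w fv fw ⟩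
          size v              ≤⟨ m≤m+n (size v) (size w) ⟩
          size v + size w     ≡⟨ size-++ v w ⟨
          size (v ++ w)       ∎)
          where open ≤-Reasoning

        fibre : ∀ i → i < suc m →
                Card (λ s → Forest (suc k) m s × firstSize s ≡ i) (f i * g (m ∸ i))
        fibre i (s≤s i≤m) = card-image
          (λ s → forest? (suc k) m s ×-dec (firstSize s ≟ i))
          (λ (v , w) → forest? 1 i v ×-dec forest? k (m ∸ i) w)
          (uncurry _++_) (λ {vw} → sound vw)
          (λ { {v , w} {v′ , w′} ((fv , _) , _) ((fv′ , _) , _) eq →
               uncurry (cong₂ _,_) (isForest-prefixFree 1 v w v′ w′ fv fv′ eq) })
          (λ {s} → onto s)
          (card-× (∣tree∣ i) (∣forest∣ (m ∸ i)))
          where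
          sound : ∀ vw → Forest 1 i (proj₁ vw) × Forest k (m ∸ i) (proj₂ vw) →
                  Forest (suc k) m (uncurry _++_ vw) × firstSize (uncurry _++_ vw) ≡ i
          sound (v , w) ((fv , refl) , (fw , eq)) =
            (++-isForest 1 k v w fv fw ,
             trans (size-++ v w) (trans (cong (size v +_) eq) (m+[n∸m]≡n i≤m))) ,
            firstSize-++ v w fv fw

          onto : ∀ s → Forest (suc k) m s × firstSize s ≡ i →
                 ∃[ vw ] (Forest 1 i (proj₁ vw) × Forest k (m ∸ i) (proj₂ vw)) ×
                         s ≡ uncurry _++_ vw
          onto s ((fs , total) , first) with v , w , fv , fw , refl ← isForest-++⁻ 1 k s fs =
            (v , w) , ((fv , v≡i) , (fw , w≡m∸i)) , refl
            where
            v≡i = trans (sym (firstSize-++ v w fv fw)) first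
            w≡m∸i : size w ≡ m ∸ i
            w≡m∸i = begin
              size w                    ≡⟨ m+n∸m≡n (size v) (size w) ⟨
              size v + size w ∸ size v  ≡⟨ cong (_∸ size v) (size-++ v w) ⟨
              size (v ++ w) ∸ size v    ≡⟨ cong₂ _∸_ total v≡i ⟩
              m ∸ i                     ∎
              where open ≡-Reasoning

    card-forest : ∀ {f} → (∀ i → Card (Forest 1 i) (f i)) →
                  ∀ k m → Card (Forest k m) (convolution f k m)
    card-forest {f} ∣tree∣ zero    m = card-forest-0 f m
    card-forest {f} ∣tree∣ (suc k) m =
      subst (Card (Forest (suc k) m)) (sym (convolution-suc f k m))
        (card-forest-suc k m ∣tree∣ (card-forest ∣tree∣ k))

    -- On the trees of positive size, the root is P (1 + rootIndex).
    rootIndex : List Symbol → ℕ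
    rootIndex []            = 0
    rootIndex ((j , _) ∷ _) = pred j

    -- Trees are grouped by their root. Deleting a root `suc i`, which has `c (suc i)` colours,
    -- leaves a forest of `arity (suc i)` trees of total size `n ∸ suc i`.
    card-tree-root : ∀ {f : ℕ → ℕ → ℕ} → (∀ k m → Card (Forest k m) (f k m)) → ∀ n → n ≥ 1 →
                     Card (Forest 1 n)
                       (sum (applyUpTo (λ i → c (suc i) * f (arity (suc i)) (n ∸ suc i)) n))
    card-tree-root {f} ∣forest∣ n n≥1 = card-fibres rootIndex _ n (λ {s} → bounded s) fibre
      where
      bounded : ∀ s → Forest 1 n s → rootIndex s < n
      bounded ((zero  , _) ∷ s) _          = n≥1
      bounded ((suc i , _) ∷ s) (_ , refl) = m≤m+n (suc i) (size s)

      fibre : ∀ i → i < n → Card (λ s → Forest 1 n s × rootIndex s ≡ i)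
                              (c (suc i) * f (arity (suc i)) (n ∸ suc i))
      fibre i i<n = card-image
        (λ s → forest? 1 n s ×-dec (rootIndex s ≟ i))
        (λ (x , s) → yes tt ×-dec forest? (arity (suc i)) (n ∸ suc i) s)
        (λ (x , s) → (suc i , x) ∷ s)
        (λ { {x , s} (_ , fs , eq) →
             (subst (λ k → IsForest k s) (sym (+-identityʳ (arity (suc i)))) fs ,
              trans (cong (suc i +_) eq) (m+[n∸m]≡n i<n)) , refl })
        (λ { _ _ refl → refl })
        (λ {s} → onto s)
        (card-× (card-⊤ (c (suc i))) (∣forest∣ (arity (suc i)) (n ∸ suc i)))
        where
        onto : ∀ s → Forest 1 n s × rootIndex s ≡ i →
               ∃[ xt ] (⊤ × Forest (arity (suc i)) (n ∸ suc i) (proj₂ xt)) ×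
                       s ≡ (suc i , proj₁ xt) ∷ proj₂ xt
        -- A root that is a leaf is the whole tree, of size 0, contrary to `n ≥ 1`.
        onto ((zero  , _) ∷ [])  ((_ , refl) , _)  = contradiction n≥1 n≮0
        onto ((suc _ , x) ∷ s)   ((fs , refl) , refl) =
          (x , s) , (tt , subst (λ k → IsForest k s) (+-identityʳ (arity (suc i))) fs ,
                     sym (m+n∸m≡n (suc i) (size s))) , refl

    -- Encoding symbol lists as coloured words

    ColouredWord : Set
    ColouredWord = Σ Word (Colouring a b c)

    -- The first ascent of the word has length `(a + b) * suc i`; dividing by `a + b` gives back the
    -- index `suc i` into `c`.
    colouring-P : ∀ i w → Colouring a b c (P a b (suc i) ++ w) ↔
                          (Fin (c (suc i)) × Colouring a b c w)
    colouring-P i w = All-∷-↔ {Q = Fin ∘ c} (_/ (a + b)) (ascents-P i w)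
      (trans (cong (_/ (a + b)) (*-comm (a + b) (suc i))) (m*n/n≡m (suc i) (a + b)))

    prepend : ∀ i → Fin (c (suc i)) → ColouredWord → ColouredWord
    prepend i x (w , xs) = P a b (suc i) ++ w , Inverse.from (colouring-P i w) (x , xs)

    prepend-injective : ∀ i i′ {x x′ w w′} → prepend i x w ≡ prepend i′ x′ w′ →
                        _≡_ {A = Symbol} (suc i , x) (suc i′ , x′) × w ≡ w′
    prepend-injective i i′ {x} {x′} {w , xs} {w′ , xs′} eq
      with refl , refl ← P-++-injective i i′ w w′ (cong proj₁ eq)
      with refl ← Injection.injective (↔⇒↣ (↔-sym (colouring-P i w))) (,-injectiveʳ eq)
      = refl , refl

    encode : List Symbol → ColouredWord
    encode []                = [] , []
    encode ((zero , _) ∷ s)  = Product.map (d ∷_) id (encode s)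
    encode ((suc i , x) ∷ s) = prepend i x (encode s)

    encode-word : ∀ s → proj₁ (encode s) ≡ concatMap (P a b) (indices s)
    encode-word []                = refl
    encode-word ((zero , _) ∷ s)  = cong (d ∷_) (encode-word s)
    encode-word ((suc i , x) ∷ s) = cong (P a b (suc i) ++_) (encode-word s)

    -- The first letter tells a leaf from a node; for a node, the first ascent and its colour then
    -- determine the symbol.
    encode-injective : ∀ s t → encode s ≡ encode t → s ≡ t
    encode-injective []                []                _  = refl
    encode-injective []                ((suc i , x) ∷ t) eq =
      contradiction (trans (cong proj₁ eq) (proj₂ (P-starts-with-u i _))) λ ()
    encode-injective ((suc i , x) ∷ s) []                eq =
      contradiction (trans (cong proj₁ (sym eq)) (proj₂ (P-starts-with-u i _))) λ ()
    encode-injective ((zero , zero) ∷ s) ((zero , zero) ∷ t) eq =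
      cong (leaf ∷_) (encode-injective s t (d∷-injective eq))
      where
      d∷-injective : ∀ {v w : ColouredWord} →
                     Product.map (d ∷_) id v ≡ Product.map (d ∷_) id w → v ≡ w
      d∷-injective refl = refl
    encode-injective ((zero , _) ∷ s)  ((suc i , x) ∷ t) eq =
      contradiction (trans (cong proj₁ eq) (proj₂ (P-starts-with-u i _))) λ ()
    encode-injective ((suc i , x) ∷ s) ((zero , _) ∷ t)  eq =
      contradiction (trans (cong proj₁ (sym eq)) (proj₂ (P-starts-with-u i _))) λ ()
    encode-injective ((suc i , x) ∷ s) ((suc i′ , x′) ∷ t) eq
      with p , q ← prepend-injective i i′ eq = cong₂ _∷_ p (encode-injective s t q)

    encode-onto : ∀ js (xs : Colouring a b c (concatMap (P a b) js)) →
                  ∃[ s ] (concatMap (P a b) js , xs) ≡ encode s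
    encode-onto []           []  = [] , refl
    encode-onto (zero  ∷ js) xs  with s , eq ← encode-onto js xs =
      (zero , zero) ∷ s , cong (Product.map (d ∷_) id) eq
    encode-onto (suc i ∷ js) xs
      with s , eq ← encode-onto js (proj₂ (Inverse.to (colouring-P i _) xs)) =
      (suc i , x) ∷ s ,
      trans (cong (_ ,_) (sym (Inverse.strictlyInverseʳ (colouring-P i _) xs)))
            (cong (prepend i x) eq)
      where x = proj₁ (Inverse.to (colouring-P i _) xs)

    #u-encode : ∀ s → #[ u ] (proj₁ (encode s)) ≡ (a + b) * size s
    #u-encode []                = sym (*-zeroʳ (a + b))
    #u-encode ((zero , _) ∷ s)  = #u-encode s
    #u-encode ((suc i , x) ∷ s) = begin
      #[ u ] (P a b (suc i) ++ w)             ≡⟨ #-++ u (P a b (suc i)) w ⟩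
      #[ u ] (P a b (suc i)) + #[ u ] w       ≡⟨ cong₂ _+_ (#u-P i) (#u-encode s) ⟩
      (a + b) * suc i + (a + b) * size s      ≡⟨ *-distribˡ-+ (a + b) (suc i) (size s) ⟨
      (a + b) * (suc i + size s)              ∎
      where
      open ≡-Reasoning
      w = proj₁ (encode s)

    -- Height `h` corresponds to `suc h` pending trees; the appended leaf closes the last one.
    descends-encode : ∀ h s → Descends h (proj₁ (encode s)) ≡ IsForest (suc h) (s ∷ʳ leaf)
    descends-encode zero    []               = refl
    descends-encode (suc h) []               = refl
    -- A `d` at height 0 closes the only pending tree before the appended leaf is read, so both
    -- sides are empty. The tail is split so that `∷ʳ` computes.
    descends-encode zero    ((zero , _) ∷ []) = refl
    descends-encode zero    ((zero , _) ∷ _ ∷ _) = refl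
    descends-encode (suc h) ((zero , _) ∷ s) = descends-encode h s
    descends-encode h       ((suc i , x) ∷ s) = begin
      Descends h (P a b (suc i) ++ w)             ≡⟨ descends-P i w eq ⟩
      Descends h′ w                               ≡⟨ descends-encode h′ s ⟩
      IsForest (suc h′) (s ∷ʳ leaf)               ≡⟨ cong (λ k → IsForest k (s ∷ʳ leaf)) eq ⟨
      IsForest (arity (suc i) + h) (s ∷ʳ leaf)    ∎
      where
      open ≡-Reasoning
      w = proj₁ (encode s)
      h′ = pred (arity (suc i) + h)
      eq : arity (suc i) + h ≡ suc h′
      eq = sym (suc-pred _ {{>-nonZero (≤-trans (0<arity i) (m≤m+n _ h))}})

    -- Open trees and coloured Dyck words

    module _ (n : ℕ) where

      openTree⇒dyck : ∀ s → OpenTree n s → IsDyck ((a + b) * n) (proj₁ (encode s))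
      openTree⇒dyck s (fs , refl) = isDyck (#u-encode s)
        (trans (descends⇒balanced 0 w 0w) (#u-encode s)) (descends⇒nonnegative 0 w 0w)
        where
        w = proj₁ (encode s)
        0w = subst id (sym (descends-encode 0 s)) fs

      openTree⇒concatenation : ∀ s → OpenTree n s → IsConcatenation a b n (proj₁ (encode s))
      openTree⇒concatenation s (_ , refl) = indices s , indices≤size s , encode-word s
        where
        indices≤size : ∀ s → All (_≤ size s) (indices s)
        indices≤size []            = []
        indices≤size ((j , _) ∷ s) =
          m≤m+n j (size s) ∷ All.map (λ i≤ → ≤-trans i≤ (m≤n+m (size s) j)) (indices≤size s)

      dyck⇒openTree : ∀ s → IsDyck ((a + b) * n) (proj₁ (encode s)) → OpenTree n s
      dyck⇒openTree s (isDyck #u #d prefixes) =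
        subst id (descends-encode 0 s) (balanced⇒descends 0 _ (trans #d (sym #u)) prefixes) ,
        *-cancelˡ-≡ (size s) n (a + b) (trans (sym (#u-encode s)) #u)

      -- The list `js` stored in `x` is irrelevant and cannot be read off. It is recovered from the
      -- position of `x` in the enumeration, which is built from such lists.
      concatenation-of : (x : 𝔇 a b c n) → ∃[ js ] ∃[ xs ]
        Σ (IsDyck ((a + b) * n) (concatMap (P a b) js)) λ dyck →
        Σ (IsConcatenation a b n (concatMap (P a b) js)) λ conc →
        x ≡ coloured (concatMap (P a b) js) dyck conc xs
      concatenation-of x
        with js , _ , x∈ ← find (∈-concatMap⁻ (λ js → colourings a b c n js (valid? a b c n js))
                                  {xs = lists≤ (upTo (suc n)) ((a + b) * n)}
                                  (∈-enumeration a b c n x))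
        with valid? a b c n js
      ... | yes (js≤n , dyck) with xs , _ , eq ← ∈-map⁻ _ x∈ =
        js , xs , dyck , (js , js≤n , refl) , eq

      toDyck : [ s ∈ List Symbol ∣ OpenTree n s ] → 𝔇 a b c n
      toDyck (s , [ p ]) = coloured (proj₁ (encode s)) (openTree⇒dyck s p)
        (openTree⇒concatenation s p) (proj₂ (encode s))

      openTree↔dyck : [ s ∈ List Symbol ∣ OpenTree n s ] ↔ 𝔇 a b c n
      openTree↔dyck = bijection (openTree? n) toDyck
        (λ {s} {t} _ _ eq → encode-injective s t
          (cong (λ x → 𝔇.word x , 𝔇.colouring x) eq))
        onto
        where
        onto : ∀ x → ∃[ s ] Σ (OpenTree n s) λ p → x ≡ toDyck (s , [ p ])
        onto x with js , xs , dyck , conc , refl ← concatenation-of x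
               with s , eq ← encode-onto js xs = s , p , same eq
          where
          p : OpenTree n s
          p = dyck⇒openTree s (subst (IsDyck _ ∘ proj₁) eq dyck)

          -- The proof fields are irrelevant, so equality of word and colouring suffices.
          same : ∀ {v w : ColouredWord} .{dyck dyck′ conc conc′} → v ≡ w →
                 _≡_ {A = 𝔇 a b c n} (coloured (proj₁ v) dyck conc (proj₂ v))
                                     (coloured (proj₁ w) dyck′ conc′ (proj₂ w))
          same refl = refl

    -- The recurrence

    card-tree-y : ∀ n → Card (Forest 1 n) (y a b c n)
    -- The convention that `y` is 1 at 0 matches the single leaf, the only tree of size 0.
    card-tree-y zero      = card-tree-0
    card-tree-y n@(suc _) =
      card-tree (↔-trans (openTree↔dyck n) (↔-sym (proj₂ (𝔇-finite {a} {b} {c} {n}))))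

theorem2p1 : (a b : ℕ) .{{_ : NonZero (a + b)}} (c : ℕ → ℕ) (n : ℕ) → n ≥ 1 →
    y a b c n ≡ ∑[ ℓ ∈ applyUpTo suc n ] (c ℓ * (∑[ i ∈ tuples (a * ℓ + b) (n ∸ ℓ) ] ∏ (map (y a b c) i)))
theorem2p1 a b c n n≥1 = trans
  -- The trees of size `n` are counted twice: through Dyck words, and by root, with `y` itself
  -- counting the trees of the remaining forest.
  (card-unique (card-tree-y a b c n)
    (card-tree-root a b c (card-forest a b c (card-tree-y a b c)) n n≥1))
  (cong sum (sym (map-applyUpTo suc
    (λ ℓ → c ℓ * convolution (y a b c) (a * ℓ + b) (n ∸ ℓ)) n)))
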